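{- (1) $\mathcal{K}^{\mathsf{TS}}(K_1)=\{k:k\ge1\}$, $\mathcal{K}^{\mathsf{TS}}(K_2)=\{1\}$, and $\mathcal{K}^{\mathsf{TS}}(K_n)=\{1,n-1\}$ for $n\ge3$. (2) $\mathcal{K}^{\mathsf{TS}}(P_n)=\{1\}$ for $n\ge2$; $\mathcal{K}^{\mathsf{TS}}(C_n)=\{1\}$ for $n\ge4$; $\mathcal{K}^{\mathsf{TS}}(K_{m,n})=\{1\}$ for all $m,n\ge1$. (3) $\mathcal{K}^{\mathsf{TS}}(B_1)=\{1,2\}$ and $\mathcal{K}^{\mathsf{TS}}(B_p)=\{1\}$ for $p\ge2$. (4) $\mathcal{K}^{\mathsf{TS}}(F_p)=\{1,2\}$ for every $p\ge1$.
   Context: All graphs are finite, simple, undirected. A $k$-clique of a graph $H$ is a set of $k$ pairwise adjacent vertices. For a graph $H$ and integer $k\ge1$, the Token Sliding graph $\mathsf{TS}_k(H)$ has as vertices the $k$-cliques of $H$, and two $k$-cliques $A,B$ are adjacent iff $A\setminus B=\{u\}$, $B\setminus A=\{v\}$ for some vertices $u,v$ with $uv\in E(H)$. For a graph $G$, $\mathcal{K}^{\mathsf{TS}}(G)=\{k\ge1:\ \exists H,\ \mathsf{TS}_k(H)\cong G\}$. $K_n$, $P_n$, $C_n$ denote the complete graph, path, cycle on $n$ vertices; $K_{m,n}$ the complete bipartite graph. The book graph $B_p$ ($p\ge1$) consists of $p$ triangles sharing a common edge; the friendship graph $F_p$ ($p\ge1$) consists of $p$ triangles sharing a common vertex (and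 otherwise disjoint). -}

module Defs where

open import Data.Bool.Properties using () renaming (_≟_ to _≟ᵇ_)
open import Data.Empty using (⊥)
open import Data.Fin using (Fin; toℕ)
import Data.Fin.Properties as Fin
open import Data.Fin.Subset using (Subset; _∈_; ∣_∣; _─_; ⁅_⁆)
open import Data.Fin.Subset.Properties using (x∈⁅x⁆; x∈⁅y⁆⇒x≡y)
open import Data.Nat using (ℕ; suc; _≤_; _≟_)
open import Data.Product using (_×_; _,_; ∃; ∃-syntax; proj₁)
open import Data.Product.Properties using () renaming (≡-dec to ×-≡-dec)
open import Data.Sum using (_⊎_; inj₁; inj₂; swap)
open import Data.Sum.Properties using () renaming (≡-dec to ⊎-≡-dec)
open import Data.Unit using (⊤; tt)
import Data.Unit.Properties as Unit
open import Data.Vec.Properties using () renaming (≡-dec to Vec-≡-dec)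
open import Function.Bundles using (_↔_; _⇔_; Inverse)
open import Level using (0ℓ) renaming (suc to lsuc)
open import Relation.Binary.Core using (Rel)
open import Relation.Binary.Definitions
  using (Decidable; DecidableEquality; Irreflexive; Symmetric)
open import Relation.Binary.PropositionalEquality
  using (_≡_; _≢_; refl; sym; trans; subst; ≢-sym)
open import Relation.Nullary using (yes; no; ¬?; _×-dec_; _⊎-dec_)
open import Relation.Unary using (Pred)

-- Simple undirected graphs with vertex type V. Finiteness is a property of V:
-- every graph below has V a finite type, and arbitrary finite graphs are
-- represented on V = Fin n. Adjacency is decidable, as for explicitly given
-- finite graphs.
record Graph (V : Set) : Set₁ where
  field
    Adj    : Rel V 0ℓ
    irrefl : Irreflexive _≡_ Adj
    symm   : Symmetric Adj
    adj?   : Decidable Adj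

open Graph public

infix 4 _≅_

record _≅_ {V W : Set} (G : Graph V) (H : Graph W) : Set where
  field
    vertices : V ↔ W
    adjacent : ∀ u v → Adj G u v ⇔ Adj H (Inverse.to vertices u) (Inverse.to vertices v)

-- The proof fields are irrelevant, so two k-cliques are propositionally equal
-- as soon as their underlying vertex sets are.
record Clique {n : ℕ} (H : Graph (Fin n)) (k : ℕ) : Set where
  constructor mkClique
  field
    set               : Subset n
    .size             : ∣ set ∣ ≡ k
    .pairwiseAdjacent : ∀ {u v} → u ∈ set → v ∈ set → u ≢ v → Adj H u v

open Clique public using (set)

TS : ∀ {n} (k : ℕ) (H : Graph (Fin n)) → Graph (Clique H k)
TS k H .Adj A B = ∃[ u ] ∃[ v ]
  (set A ─ set B ≡ ⁅ u ⁆ × set B ─ set A ≡ ⁅ v ⁆ × Adj H u v)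
TS k H .irrefl refl (u , v , p , q , uv) =
  irrefl H (x∈⁅y⁆⇒x≡y v (subst (u ∈_) (trans (sym p) q) (x∈⁅x⁆ u))) uv
TS k H .symm (u , v , p , q , uv) = v , u , q , p , symm H uv
TS k H .adj? A B = Fin.any? λ u → Fin.any? λ v →
  ((set A ─ set B) ≟ˢ ⁅ u ⁆) ×-dec ((set B ─ set A) ≟ˢ ⁅ v ⁆) ×-dec adj? H u v
  where _≟ˢ_ = Vec-≡-dec _≟ᵇ_

𝒦ᵀˢ : {V : Set} → Graph V → Pred ℕ (lsuc 0ℓ)
𝒦ᵀˢ G k = 1 ≤ k × ∃[ n ] ∃ λ (H : Graph (Fin n)) → TS k H ≅ G

-- The simple graph generated by R: symmetric closure with loops discarded.
fromRel : {V : Set} {R : Rel V 0ℓ} → DecidableEquality V → Decidable R → Graph V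
fromRel {R = R} _≟ⱽ_ R? = record
  { Adj    = λ u v → u ≢ v × (R u v ⊎ R v u)
  ; irrefl = λ u≡v uv → proj₁ uv u≡v
  ; symm   = λ (u≢v , r) → ≢-sym u≢v , swap r
  ; adj?   = λ u v → ¬? (u ≟ⱽ v) ×-dec (R? u v ⊎-dec R? v u)
  }

complete : ∀ n → Graph (Fin n)
complete n = record
  { Adj    = _≢_
  ; irrefl = λ u≡v u≢v → u≢v u≡v
  ; symm   = ≢-sym
  ; adj?   = λ u v → ¬? (u Fin.≟ v)
  }

path : ∀ n → Graph (Fin n)
path n = fromRel {R = λ i j → suc (toℕ i) ≡ toℕ j} Fin._≟_
  (λ i j → suc (toℕ i) ≟ toℕ j)

-- A cycle only for n ≥ 3.
cycle : ∀ n → Graph (Fin n)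
cycle n = fromRel
  {R = λ i j → suc (toℕ i) ≡ toℕ j ⊎ (suc (toℕ i) ≡ n × toℕ j ≡ 0)} Fin._≟_
  (λ i j → (suc (toℕ i) ≟ toℕ j) ⊎-dec ((suc (toℕ i) ≟ n) ×-dec (toℕ j ≟ 0)))

LeftRight : {A B : Set} → Rel (A ⊎ B) 0ℓ
LeftRight (inj₁ _) (inj₂ _) = ⊤
LeftRight _        _        = ⊥

leftRight? : {A B : Set} → Decidable (LeftRight {A} {B})
leftRight? (inj₁ _) (inj₂ _) = yes tt
leftRight? (inj₁ _) (inj₁ _) = no λ ()
leftRight? (inj₂ _) (inj₁ _) = no λ ()
leftRight? (inj₂ _) (inj₂ _) = no λ ()

completeBipartite : ∀ m n → Graph (Fin m ⊎ Fin n)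
completeBipartite m n = fromRel (⊎-≡-dec Fin._≟_ Fin._≟_) leftRight?

FromLeft : {A B : Set} → Rel (A ⊎ B) 0ℓ
FromLeft (inj₁ _) _ = ⊤
FromLeft (inj₂ _) _ = ⊥

fromLeft? : {A B : Set} → Decidable (FromLeft {A} {B})
fromLeft? (inj₁ _) _ = yes tt
fromLeft? (inj₂ _) _ = no λ ()

-- Fin 2 is the common edge; each element of Fin p is the apex of one triangle.
book : ∀ p → Graph (Fin 2 ⊎ Fin p)
book p = fromRel (⊎-≡-dec Fin._≟_ Fin._≟_) fromLeft?

HubOrSameTriangle : ∀ {p} → Rel (⊤ ⊎ (Fin p × Fin 2)) 0ℓ
HubOrSameTriangle (inj₁ _)       _              = ⊤
HubOrSameTriangle (inj₂ _)       (inj₁ _)       = ⊥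
HubOrSameTriangle (inj₂ (i , _)) (inj₂ (j , _)) = i ≡ j

hubOrSameTriangle? : ∀ {p} → Decidable (HubOrSameTriangle {p})
hubOrSameTriangle? (inj₁ _)       _              = yes tt
hubOrSameTriangle? (inj₂ _)       (inj₁ _)       = no λ ()
hubOrSameTriangle? (inj₂ (i , _)) (inj₂ (j , _)) = i Fin.≟ j

-- inj₁ tt is the common vertex; inj₂ (i , 0) and inj₂ (i , 1) are the other two
-- vertices of the i-th triangle.
friendship : ∀ p → Graph (⊤ ⊎ (Fin p × Fin 2))
friendship p = fromRel (⊎-≡-dec Unit._≟_ (×-≡-dec Fin._≟_ Fin._≟_)) hubOrSameTriangle?

{-# OPTIONS --safe #-}
-- If k-cliques A and B are adjacent in TS_k(H), then A ∪ B is a (k+1)-clique of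
-- H, and its k-subsets form a K_{k+1} in TS_k(H). Hence a graph that has an
-- edge but no K_m only has k + 1 < m. For K_n, a k-clique adjacent to all
-- k-subsets of a (k+1)-clique forces k = 1, so otherwise n = k + 1. For k = 2
-- the symmetric difference of adjacent A and C is a common neighbour of A and C;
-- in B_p the edge from a spine vertex A to an apex C has the other spine vertex
-- B as its only common neighbour, so C is determined by A and B and p = 1.
-- Conversely TS_{n-1}(K_n) ≅ K_n and TS_2(B_p) ≅ F_p.
module Submission where

open import Defs
open import Data.Bool using (true; false)
open import Data.Empty using (⊥; ⊥-elim)
open import Data.Fin using (Fin; zero; suc; toℕ; inject≤)
import Data.Fin.Properties as Fin
open import Data.Fin.Subset using (Subset; _∈_; _∉_; ∣_∣; _─_; _-_; ⁅_⁆; ∁)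
  renaming (⊤ to full; ⊥ to empty; _∪_ to _∪ˢ_)
open import Data.Fin.Subset.Properties
open import Data.Nat using (ℕ; zero; suc; _+_; _*_; _≤_; _<_; _∸_; _≟_; _<?_; z≤n; s≤s)
import Data.Nat.Properties as ℕ
open import Data.Product using (_×_; _,_; ∃; ∃-syntax; proj₁; proj₂)
open import Data.Sum using (_⊎_; inj₁; inj₂; [_,_]′)
open import Data.Sum.Function.Propositional using (_⊎-↔_)
open import Data.Unit using (⊤; tt)
open import Data.Vec using (_∷_; []; here; there)
open import Data.Vec.Properties using (∷-injectiveʳ)
open import Function using (_∘_; Injective)
open import Function.Bundles using (_↔_; _⇔_; mk⇔; mk↔ₛ′; Inverse; Equivalence)
open import Function.Properties.Inverse using (↔-refl; ↔-sym; ↔-trans)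
open import Level using (0ℓ)
open import Relation.Binary.Core using (Rel)
open import Relation.Binary.Definitions using (Decidable; DecidableEquality)
open import Relation.Binary.PropositionalEquality
open import Relation.Nullary
  using (¬_; yes; no; Dec; recompute; contradiction; _→-dec_; _×-dec_; _⊎-dec_)
open import Relation.Nullary.Decidable using (toSum)
open import Relation.Unary using (_≐_; _∪_; ｛_｝)

private variable
  n k m p : ℕ
  V W U : Set

-- Finite subsets

x∈p─q⇒x∉q : ∀ {x : Fin n} (p q : Subset n) → x ∈ p ─ q → x ∉ q
x∈p─q⇒x∉q (_ ∷ _) (true ∷ _)  () here
x∈p─q⇒x∉q (_ ∷ p) (_ ∷ q) (there x∈) (there x∈q) = x∈p─q⇒x∉q p q x∈ x∈q

-- Introduction and, with `─≡⁅⁆⁻`, elimination for the two set equations in the adjacency of `TS`.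
─≡⁅⁆⁺ : ∀ {p q : Subset n} {u} → u ∈ p → u ∉ q →
        (∀ {x} → x ∈ p → x ∉ q → x ≡ u) → p ─ q ≡ ⁅ u ⁆
─≡⁅⁆⁺ {p = p} {q} {u} u∈p u∉q uniq = ⊆-antisym
  (λ x∈ → subst (_∈ ⁅ u ⁆) (sym (uniq (p─q⊆p p q x∈) (x∈p─q⇒x∉q p q x∈))) (x∈⁅x⁆ u))
  (λ x∈ → subst (_∈ p ─ q) (sym (x∈⁅y⁆⇒x≡y u x∈)) (x∈p∧x∉q⇒x∈p─q u∈p u∉q))

─≡⁅⁆⁻ : ∀ {p q : Subset n} {u} → p ─ q ≡ ⁅ u ⁆ →
        u ∈ p × u ∉ q × (∀ {x} → x ∈ p → x ∉ q → x ≡ u)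
─≡⁅⁆⁻ {p = p} {q} {u} eq = p─q⊆p p q u∈ , x∈p─q⇒x∉q p q u∈ ,
  λ x∈p x∉q → x∈⁅y⁆⇒x≡y u (subst (_ ∈_) eq (x∈p∧x∉q⇒x∈p─q x∈p x∉q))
  where
  u∈ : u ∈ p ─ q
  u∈ = subst (u ∈_) (sym eq) (x∈⁅x⁆ u)

⊥─p≡⊥ : ∀ (p : Subset n) → empty ─ p ≡ empty
⊥─p≡⊥ p = Empty-unique λ (x , x∈) → ∉⊥ (p─q⊆p empty p x∈)

p─p≡⊥ : ∀ (p : Subset n) → p ─ p ≡ empty
p─p≡⊥ p = Empty-unique λ (x , x∈) → x∈p─q⇒x∉q p p x∈ (p─q⊆p p p x∈)

-- Exclusive or with a fixed bit is injective; where the heads of `q` and `r` differ, the heads of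
-- the equation clash. This recovers an apex of a book from a spine vertex and a symmetric
-- difference.
symmetricDifference-cancelˡ : ∀ (p q r : Subset n) →
  (p ─ q) ∪ˢ (q ─ p) ≡ (p ─ r) ∪ˢ (r ─ p) → q ≡ r
symmetricDifference-cancelˡ [] [] [] _ = refl
symmetricDifference-cancelˡ (true ∷ p) (true ∷ q) (true ∷ r) eq =
  cong (true ∷_) (symmetricDifference-cancelˡ p q r (∷-injectiveʳ eq))
symmetricDifference-cancelˡ (true ∷ p) (false ∷ q) (false ∷ r) eq =
  cong (false ∷_) (symmetricDifference-cancelˡ p q r (∷-injectiveʳ eq))
symmetricDifference-cancelˡ (false ∷ p) (true ∷ q) (true ∷ r) eq =
  cong (true ∷_) (symmetricDifference-cancelˡ p q r (∷-injectiveʳ eq))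
symmetricDifference-cancelˡ (false ∷ p) (false ∷ q) (false ∷ r) eq =
  cong (false ∷_) (symmetricDifference-cancelˡ p q r (∷-injectiveʳ eq))

x∉p-x : ∀ (p : Subset n) x → x ∉ p - x
x∉p-x p x x∈ = x∈p─q⇒x∉q p ⁅ x ⁆ x∈ (x∈⁅x⁆ x)

x∈p⇒∣p∣≡1+∣p-x∣ : ∀ {x} (p : Subset n) → x ∈ p → ∣ p ∣ ≡ suc ∣ p - x ∣
x∈p⇒∣p∣≡1+∣p-x∣ (true ∷ p)  here        = cong (suc ∘ ∣_∣) (sym (p─⊥≡p p))
x∈p⇒∣p∣≡1+∣p-x∣ (true ∷ p)  (there x∈p) = cong suc (x∈p⇒∣p∣≡1+∣p-x∣ p x∈p)
x∈p⇒∣p∣≡1+∣p-x∣ (false ∷ p) (there x∈p) = x∈p⇒∣p∣≡1+∣p-x∣ p x∈p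

x∉p⇒∣p∪⁅x⁆∣≡1+∣p∣ : ∀ (p : Subset n) x → x ∉ p → ∣ p ∪ˢ ⁅ x ⁆ ∣ ≡ suc ∣ p ∣
x∉p⇒∣p∪⁅x⁆∣≡1+∣p∣ (true ∷ p)  zero    x∉ = contradiction here x∉
x∉p⇒∣p∪⁅x⁆∣≡1+∣p∣ (false ∷ p) zero    x∉ = cong (suc ∘ ∣_∣) (∪-identityʳ p)
x∉p⇒∣p∪⁅x⁆∣≡1+∣p∣ (true ∷ p)  (suc x) x∉ = cong suc (x∉p⇒∣p∪⁅x⁆∣≡1+∣p∣ p x (x∉ ∘ there))
x∉p⇒∣p∪⁅x⁆∣≡1+∣p∣ (false ∷ p) (suc x) x∉ = x∉p⇒∣p∪⁅x⁆∣≡1+∣p∣ p x (x∉ ∘ there)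

∣p∣≡0⇒p≡⊥ : ∀ (p : Subset n) → ∣ p ∣ ≡ 0 → p ≡ empty
∣p∣≡0⇒p≡⊥ []          _  = refl
∣p∣≡0⇒p≡⊥ (false ∷ p) eq = cong (false ∷_) (∣p∣≡0⇒p≡⊥ p eq)

∣p∣≡1⇒p≡⁅x⁆ : ∀ (p : Subset n) → ∣ p ∣ ≡ 1 → ∃[ x ] p ≡ ⁅ x ⁆
∣p∣≡1⇒p≡⁅x⁆ (true ∷ p)  eq = zero , cong (true ∷_) (∣p∣≡0⇒p≡⊥ p (ℕ.suc-injective eq))
∣p∣≡1⇒p≡⁅x⁆ (false ∷ p) eq with x , refl ← ∣p∣≡1⇒p≡⁅x⁆ p eq = suc x , refl

⁅⁆-injective : ∀ {x y : Fin n} → ⁅ x ⁆ ≡ ⁅ y ⁆ → x ≡ y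
⁅⁆-injective {x = x} {y} eq = x∈⁅y⁆⇒x≡y y (subst (x ∈_) eq (x∈⁅x⁆ x))

-- Indexes the members of a clique by `Fin`, so that the deletions of single vertices form a family
-- to which `CliqueFree` and counting apply.
enum : (p : Subset n) → Fin ∣ p ∣ → ∃ (_∈ p)
enum (true ∷ p)  zero    = zero , here
enum (true ∷ p)  (suc i) = let x , x∈p = enum p i in suc x , there x∈p
enum (false ∷ p) i       = let x , x∈p = enum p i in suc x , there x∈p

enum-injective : ∀ (p : Subset n) {i j} → proj₁ (enum p i) ≡ proj₁ (enum p j) → i ≡ j
enum-injective (true ∷ p)  {zero}  {zero}  eq = refl
enum-injective (true ∷ p)  {suc i} {suc j} eq = cong suc (enum-injective p (Fin.suc-injective eq))
enum-injective (false ∷ p) eq = enum-injective p (Fin.suc-injective eq)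

enum-surjective : ∀ (p : Subset n) {x} → x ∈ p → ∃[ i ] proj₁ (enum p i) ≡ x
enum-surjective (true ∷ p)  here        = zero , refl
enum-surjective (true ∷ p)  (there x∈p) =
  let i , eq = enum-surjective p x∈p in suc i , cong suc eq
enum-surjective (false ∷ p) (there x∈p) =
  let i , eq = enum-surjective p x∈p in i , cong suc eq

-- Graph isomorphisms

open Inverse using (to; from; strictlyInverseˡ; strictlyInverseʳ)
open _≅_

from-injective : (φ : V ↔ W) → Injective _≡_ _≡_ (from φ)
from-injective φ {x} {y} eq =
  trans (sym (strictlyInverseˡ φ x)) (trans (cong (to φ) eq) (strictlyInverseˡ φ y))

≅-sym : {G : Graph V} {H : Graph W} → G ≅ H → H ≅ G
≅-sym {H = H} φ = record
  { vertices = ↔-sym (vertices φ)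
  ; adjacent = λ u v → mk⇔
      (λ uv → Equivalence.from (adjacent φ _ _) (subst₂ (Adj H) (sym (inv u)) (sym (inv v)) uv))
      (λ uv → subst₂ (Adj H) (inv u) (inv v) (Equivalence.to (adjacent φ _ _) uv))
  }
  where inv = strictlyInverseˡ (vertices φ)

≅-trans : {F : Graph U} {G : Graph V} {H : Graph W} → F ≅ G → G ≅ H → F ≅ H
≅-trans φ ψ = record
  { vertices = ↔-trans (vertices φ) (vertices ψ)
  ; adjacent = λ u v → mk⇔
      (Equivalence.to (adjacent ψ _ _) ∘ Equivalence.to (adjacent φ u v))
      (Equivalence.from (adjacent φ u v) ∘ Equivalence.from (adjacent ψ _ _))
  }

bijection⇒≅ : {G : Graph V} {H : Graph W} (f : V → W) → Injective _≡_ _≡_ f →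
  (∀ w → ∃[ v ] f v ≡ w) → (∀ u v → Adj G u v ⇔ Adj H (f u) (f v)) → G ≅ H
bijection⇒≅ f inj surj adj = record
  { vertices = mk↔ₛ′ f (proj₁ ∘ surj) (proj₂ ∘ surj) (λ v → inj (proj₂ (surj (f v))))
  ; adjacent = adj
  }

𝒦-resp-≅ : {G : Graph V} {G′ : Graph W} → G ≅ G′ → 𝒦ᵀˢ G k → 𝒦ᵀˢ G′ k
𝒦-resp-≅ φ (1≤k , n , H , ψ) = 1≤k , n , H , ≅-trans ψ φ

pullback : (W → V) → Graph V → Graph W
pullback f G = record
  { Adj    = λ u v → Adj G (f u) (f v)
  ; irrefl = irrefl G ∘ cong f
  ; symm   = symm G
  ; adj?   = λ u v → adj? G (f u) (f v)
  }

-- Irreflexivity of adjacency makes such an `f` injective, so exactly the copies of K_m are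
-- excluded.
CliqueFree : ℕ → Graph V → Set
CliqueFree m G = ∀ (f : Fin m → _) → ¬ (∀ {i j} → i ≢ j → Adj G (f i) (f j))

-- By pigeonhole, two of `suc m` pairwise adjacent vertices share one of the `m` colours.
colourable⇒cliqueFree : (G : Graph V) (c : V → Fin m) →
  (∀ u v → Adj G u v → c u ≢ c v) → CliqueFree (suc m) G
colourable⇒cliqueFree G c proper f clique =
  let i , j , i<j , eq = Fin.pigeonhole (ℕ.n<1+n _) (c ∘ f)
  in proper _ _ (clique (Fin.<⇒≢ i<j)) eq

-- Cliques and token sliding

Clique-≡ : {H : Graph (Fin n)} {A B : Clique H k} → set A ≡ set B → A ≡ B
Clique-≡ {A = mkClique _ _ _} {B = mkClique _ _ _} refl = refl

module _ {H : Graph (Fin n)} where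

  -- The proofs stored in a `Clique` are irrelevant; they are recovered by deciding the proposition,
  -- here equality of naturals and in `clique-adj` adjacency.
  size-≡ : (A : Clique H k) → ∣ set A ∣ ≡ k
  size-≡ {k} (mkClique p eq _) = recompute (∣ p ∣ ≟ k) eq

  clique-adj : (A : Clique H k) → ∀ {u v} → u ∈ set A → v ∈ set A → u ≢ v → Adj H u v
  clique-adj (mkClique _ _ adj) {u} {v} u∈ v∈ u≢v = recompute (adj? H u v) (adj u∈ v∈ u≢v)

  -- A vertex of `A` that lies in `B` is adjacent to `v` within the clique `B`; the only other one
  -- is `u`, adjacent to `v` by the slide.
  slide⇒clique : (A B : Clique H k) → Adj (TS k H) A B → Clique H (suc k)
  slide⇒clique A B (u , v , A─B , B─A , uv) =
    mkClique (set A ∪ˢ ⁅ v ⁆)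
      (trans (x∉p⇒∣p∪⁅x⁆∣≡1+∣p∣ (set A) v v∉A) (cong suc (size-≡ A))) adjacent′
    where
    v∈B = proj₁ (─≡⁅⁆⁻ B─A)
    v∉A = proj₁ (proj₂ (─≡⁅⁆⁻ B─A))

    v-adj : ∀ {x} → x ∈ set A → Adj H x v
    v-adj {x} x∈A with x ∈? set B
    ... | yes x∈B = clique-adj B x∈B v∈B (λ { refl → v∉A x∈A })
    ... | no  x∉B with refl ← proj₂ (proj₂ (─≡⁅⁆⁻ A─B)) x∈A x∉B = uv

    adjacent′ : ∀ {x y} → x ∈ set A ∪ˢ ⁅ v ⁆ → y ∈ set A ∪ˢ ⁅ v ⁆ → x ≢ y → Adj H x y
    adjacent′ x∈ y∈ x≢y with x∈p∪q⁻ (set A) ⁅ v ⁆ x∈ | x∈p∪q⁻ (set A) ⁅ v ⁆ y∈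
    ... | inj₁ x∈A | inj₁ y∈A = clique-adj A x∈A y∈A x≢y
    ... | inj₁ x∈A | inj₂ y∈v with refl ← x∈⁅y⁆⇒x≡y v y∈v = v-adj x∈A
    ... | inj₂ x∈v | inj₁ y∈A with refl ← x∈⁅y⁆⇒x≡y v x∈v = symm H (v-adj y∈A)
    ... | inj₂ x∈v | inj₂ y∈v =
      contradiction (trans (x∈⁅y⁆⇒x≡y v x∈v) (sym (x∈⁅y⁆⇒x≡y v y∈v))) x≢y

  -- Irrelevance of the membership proof makes the result depend on `Q` and `x` only, so deletions
  -- reached by different proofs agree definitionally.
  delete : (Q : Clique H (suc k)) → ∀ x → .(x ∈ set Q) → Clique H k
  delete Q x x∈Q = mkClique (set Q - x)
    (ℕ.suc-injective (trans (sym (x∈p⇒∣p∣≡1+∣p-x∣ (set Q) x∈Q)) (size-≡ Q)))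
    (λ u∈ v∈ → clique-adj Q (p─q⊆p _ ⁅ x ⁆ u∈) (p─q⊆p _ ⁅ x ⁆ v∈))

  delete-adj : (Q : Clique H (suc k)) → ∀ {x y} (x∈Q : x ∈ set Q) (y∈Q : y ∈ set Q) →
    x ≢ y → Adj (TS k H) (delete Q x x∈Q) (delete Q y y∈Q)
  delete-adj Q {x} {y} x∈Q y∈Q x≢y =
    -- The set without `x` still contains `y`, so the token on `y` slides to `x`.
    y , x , diff y∈Q (≢-sym x≢y) , diff x∈Q x≢y , clique-adj Q y∈Q x∈Q (≢-sym x≢y)
    where
    diff : ∀ {a b} → b ∈ set Q → b ≢ a → (set Q - a) ─ (set Q - b) ≡ ⁅ b ⁆
    diff {a} {b} b∈Q b≢a = ─≡⁅⁆⁺ (x∈p∧x≢y⇒x∈p-y b∈Q b≢a) (x∉p-x (set Q) b) only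
      where
      only : ∀ {z} → z ∈ set Q - a → z ∉ set Q - b → z ≡ b
      only {z} z∈ z∉ with z Fin.≟ b
      ... | yes z≡b = z≡b
      ... | no  z≢b = contradiction (x∈p∧x≢y⇒x∈p-y (p─q⊆p _ ⁅ a ⁆ z∈) z≢b) z∉

  deleteNth : (Q : Clique H (suc k)) → Fin ∣ set Q ∣ → Clique H k
  deleteNth Q i = let x , x∈Q = enum (set Q) i in delete Q x x∈Q

  deleteNth-adj : (Q : Clique H (suc k)) → ∀ {i j} → i ≢ j →
    Adj (TS k H) (deleteNth Q i) (deleteNth Q j)
  deleteNth-adj Q i≢j = delete-adj Q (proj₂ (enum _ _)) (proj₂ (enum _ _))
    (i≢j ∘ enum-injective (set Q))

  -- By size, `C` misses some `x` in `Q`, and its one vertex `c` outside `set Q - x` then lies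
  -- outside `Q`. Comparing `C` with the other deletions leaves no room for a second vertex of `C`.
  adjacent-to-all⇒k≡1 : (Q : Clique H (suc k)) (C : Clique H k) →
    (∀ {x} (x∈Q : x ∈ set Q) → Adj (TS k H) C (delete Q x x∈Q)) → k ≡ 1
  adjacent-to-all⇒k≡1 {k} Q C adj with Fin.all? (λ x → (x ∈? set Q) →-dec (x ∈? set C))
  ... | yes Q⊆C = contradiction
    (subst₂ _≤_ (size-≡ Q) (size-≡ C) (p⊆q⇒∣p∣≤∣q∣ (λ {x} → Q⊆C x))) ℕ.1+n≰n
  ... | no ¬Q⊆C = trans (sym (size-≡ C)) (trans (cong ∣_∣ C≡⁅c⁆) (∣⁅x⁆∣≡1 c))
    where
    missing : ∃[ x ] x ∈ set Q × x ∉ set C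
    missing with x , ¬imp ← Fin.¬∀⟶∃¬ _ _ (λ x → (x ∈? set Q) →-dec (x ∈? set C)) ¬Q⊆C
            with x ∈? set Q
    ... | yes x∈Q = x , x∈Q , λ x∈C → ¬imp (λ _ → x∈C)
    ... | no  x∉Q = contradiction (λ x∈Q → contradiction x∈Q x∉Q) ¬imp

    x   = proj₁ missing
    x∈Q = proj₁ (proj₂ missing)
    x∉C = proj₂ (proj₂ missing)
    c   = proj₁ (adj x∈Q)

    c-spec : c ∈ set C × c ∉ set Q - x × (∀ {y} → y ∈ set C → y ∉ set Q - x → y ≡ c)
    c-spec = ─≡⁅⁆⁻ (proj₁ (proj₂ (proj₂ (adj x∈Q))))

    c∈C = proj₁ c-spec

    c∉Q : c ∉ set Q
    -- `c` differs from `x` because `x` is not in `C`, so membership in `Q` would put it in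
    -- `set Q - x`.
    c∉Q c∈Q = proj₁ (proj₂ c-spec)
      (x∈p∧x≢y⇒x∈p-y c∈Q (λ c≡x → x∉C (subst (_∈ set C) c≡x c∈C)))

    only : ∀ {y} → y ∈ set C → y ≡ c
    only {y} y∈C with y ∈? set Q
    ... | no  y∉Q = proj₂ (proj₂ c-spec) y∈C (y∉Q ∘ p─q⊆p (set Q) ⁅ x ⁆)
    -- Both `y` and `c` lie in `C` but not in `set Q - y`, and only one vertex does.
    ... | yes y∈Q =
      let _ , _ , C─ , _ = adj y∈Q
          _ , _ , uniq   = ─≡⁅⁆⁻ C─
      in trans (uniq y∈C (x∉p-x (set Q) y)) (sym (uniq c∈C (c∉Q ∘ p─q⊆p (set Q) ⁅ y ⁆)))

    C≡⁅c⁆ : set C ≡ ⁅ c ⁆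
    C≡⁅c⁆ = ⊆-antisym
      (λ y∈C → subst (_∈ ⁅ c ⁆) (sym (only y∈C)) (x∈⁅x⁆ c))
      (λ y∈c → subst (_∈ set C) (sym (x∈⁅y⁆⇒x≡y c y∈c)) c∈C)

  -- With A = {u, w} and C = {v, w}, the clique D = {u, v} becomes `A` by sliding `v` to `w`, along
  -- the edge that is `C`.
  symmetricDifference-clique : (A C : Clique H 2) → Adj (TS 2 H) A C →
    ∃[ D ] (set D ≡ (set A ─ set C) ∪ˢ (set C ─ set A) × Adj (TS 2 H) D A)
  symmetricDifference-clique A C (u , v , A─C , C─A , uv) =
    D , sym (cong₂ _∪ˢ_ A─C C─A) , v , w ,
    ─≡⁅⁆⁺ v∈D v∉A D─A-only ,
    ─≡⁅⁆⁺ w∈A w∉D A─D-only ,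
    clique-adj C v∈C w∈C (≢-sym w≢v)
    where
    u∈A = proj₁ (─≡⁅⁆⁻ A─C)
    v∈C = proj₁ (─≡⁅⁆⁻ C─A)
    v∉A = proj₁ (proj₂ (─≡⁅⁆⁻ C─A))

    v∉⁅u⁆ : v ∉ ⁅ u ⁆
    v∉⁅u⁆ v∈ = irrefl H (sym (x∈⁅y⁆⇒x≡y u v∈)) uv

    pair-adj : ∀ {x y} → x ∈ ⁅ u ⁆ ∪ˢ ⁅ v ⁆ → y ∈ ⁅ u ⁆ ∪ˢ ⁅ v ⁆ → x ≢ y → Adj H x y
    pair-adj x∈ y∈ x≢y with x∈p∪q⁻ ⁅ u ⁆ ⁅ v ⁆ x∈ | x∈p∪q⁻ ⁅ u ⁆ ⁅ v ⁆ y∈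
    ... | inj₁ x∈u | inj₁ y∈u =
      contradiction (trans (x∈⁅y⁆⇒x≡y u x∈u) (sym (x∈⁅y⁆⇒x≡y u y∈u))) x≢y
    ... | inj₁ x∈u | inj₂ y∈v =
      subst₂ (Adj H) (sym (x∈⁅y⁆⇒x≡y u x∈u)) (sym (x∈⁅y⁆⇒x≡y v y∈v)) uv
    ... | inj₂ x∈v | inj₁ y∈u =
      subst₂ (Adj H) (sym (x∈⁅y⁆⇒x≡y v x∈v)) (sym (x∈⁅y⁆⇒x≡y u y∈u)) (symm H uv)
    ... | inj₂ x∈v | inj₂ y∈v =
      contradiction (trans (x∈⁅y⁆⇒x≡y v x∈v) (sym (x∈⁅y⁆⇒x≡y v y∈v))) x≢y

    D : Clique H 2
    D = mkClique (⁅ u ⁆ ∪ˢ ⁅ v ⁆)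
      (trans (x∉p⇒∣p∪⁅x⁆∣≡1+∣p∣ ⁅ u ⁆ v v∉⁅u⁆) (cong suc (∣⁅x⁆∣≡1 u))) pair-adj

    v∈D = x∈p∪q⁺ {p = ⁅ u ⁆} (inj₂ (x∈⁅x⁆ v))

    rest : ∃[ w ] set A - u ≡ ⁅ w ⁆
    rest = ∣p∣≡1⇒p≡⁅x⁆ (set A - u)
      (ℕ.suc-injective (trans (sym (x∈p⇒∣p∣≡1+∣p-x∣ (set A) u∈A)) (size-≡ A)))

    w = proj₁ rest

    w-spec : w ∈ set A × w ∉ ⁅ u ⁆ × (∀ {x} → x ∈ set A → x ∉ ⁅ u ⁆ → x ≡ w)
    w-spec = ─≡⁅⁆⁻ (proj₂ rest)

    w∈A = proj₁ w-spec

    w≢v : w ≢ v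
    w≢v w≡v = v∉A (subst (_∈ set A) w≡v w∈A)

    w∈C : w ∈ set C
    w∈C with w ∈? set C
    ... | yes w∈C = w∈C
    -- The only vertex of `A` outside `C` is `u`, and `w` is not `u`.
    ... | no  w∉C = contradiction
      (subst (_∈ ⁅ u ⁆) (sym (proj₂ (proj₂ (─≡⁅⁆⁻ A─C)) w∈A w∉C)) (x∈⁅x⁆ u))
      (proj₁ (proj₂ w-spec))

    w∉D : w ∉ set D
    w∉D w∈D = [ proj₁ (proj₂ w-spec) , w≢v ∘ x∈⁅y⁆⇒x≡y v ]′ (x∈p∪q⁻ ⁅ u ⁆ ⁅ v ⁆ w∈D)

    D─A-only : ∀ {x} → x ∈ set D → x ∉ set A → x ≡ v
    D─A-only x∈D x∉A with x∈p∪q⁻ ⁅ u ⁆ ⁅ v ⁆ x∈D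
    ... | inj₁ x∈u = contradiction (subst (_∈ set A) (sym (x∈⁅y⁆⇒x≡y u x∈u)) u∈A) x∉A
    ... | inj₂ x∈v = x∈⁅y⁆⇒x≡y v x∈v

    A─D-only : ∀ {x} → x ∈ set A → x ∉ set D → x ≡ w
    A─D-only x∈A x∉D = proj₂ (proj₂ w-spec) x∈A (x∉D ∘ x∈p∪q⁺ ∘ inj₁)

  -- The previous construction is applied to both orders of the pair; commutativity of union
  -- identifies the two resulting cliques.
  symmetricDifference-common : (A C : Clique H 2) → Adj (TS 2 H) A C →
    ∃[ D ] (set D ≡ (set A ─ set C) ∪ˢ (set C ─ set A) × Adj (TS 2 H) D A × Adj (TS 2 H) D C)
  symmetricDifference-common A C AC
    with D , D≡ , DA ← symmetricDifference-clique A C AC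
       | D′ , D′≡ , D′C ← symmetricDifference-clique C A (symm (TS 2 H) {A} {C} AC)
    = D , D≡ , DA , subst (λ X → Adj (TS 2 H) X C) D′≡D D′C
    where
    D′≡D : D′ ≡ D
    D′≡D = Clique-≡ (trans D′≡ (trans (∪-comm _ _) (sym D≡)))

-- Bounds on k from a Token Sliding representation

module _ {H : Graph (Fin n)} {G : Graph V} (φ : TS k H ≅ G) where

  edge-pull : ∀ {u v} → Adj G u v → Adj (TS k H) (from (vertices φ) u) (from (vertices φ) v)
  edge-pull = Equivalence.to (adjacent (≅-sym {G = TS k H} {H = G} φ) _ _)

  edge-push : ∀ {A B} → Adj (TS k H) A B → Adj G (to (vertices φ) A) (to (vertices φ) B)
  edge-push {A} {B} = Equivalence.to (adjacent φ A B)

  edge⇒clique : ∀ {u v} → Adj G u v → Clique H (suc k)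
  edge⇒clique {u} {v} uv =
    slide⇒clique (from (vertices φ) u) (from (vertices φ) v) (edge-pull uv)

  -- If m were at most k + 1, then m of the deletions from the (k + 1)-clique `Q` would map to a K_m
  -- in `G`.
  cliqueFree-bound : ∀ {u v} → Adj G u v → CliqueFree m G → suc k < m
  cliqueFree-bound {m = m} uv free with suc k <? m
  ... | yes 1+k<m = 1+k<m
  ... | no  1+k≮m = ⊥-elim (free
    (λ i → to (vertices φ) (deleteNth Q (inject≤ i m≤∣Q∣)))
    (λ i≢j → edge-push (deleteNth-adj Q (i≢j ∘ Fin.inject≤-injective m≤∣Q∣ m≤∣Q∣ _ _))))
    where
    Q     = edge⇒clique uv
    m≤∣Q∣ : m ≤ ∣ set Q ∣
    m≤∣Q∣ = subst (m ≤_) (sym (size-≡ Q)) (ℕ.≮⇒≥ 1+k≮m)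

𝒦-bound : {G : Graph V} {u v : V} → Adj G u v → CliqueFree m G → 𝒦ᵀˢ G k → suc k < m
𝒦-bound uv free (_ , _ , _ , φ) = cliqueFree-bound φ uv free

-- The equation is oriented as membership in `｛ 1 ｝` unfolds.
𝒦-triangle-free : {G : Graph V} {u v : V} → Adj G u v → CliqueFree 3 G → 𝒦ᵀˢ G k → 1 ≡ k
𝒦-triangle-free uv free k∈ = ℕ.≤-antisym (proj₁ k∈) (ℕ.≤-pred (ℕ.≤-pred (𝒦-bound uv free k∈)))

-- `H` is `G` relabelled by `Fin n`. Distinct singletons are disjoint, so their differences are the
-- singletons themselves and a slide between them is just an edge of `H`.
1∈𝒦 : V ↔ Fin n → (G : Graph V) → 𝒦ᵀˢ G 1
1∈𝒦 φ G = s≤s z≤n , _ , H , ≅-sym (bijection⇒≅ vertex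
  (λ eq → from-injective (↔-sym φ) (⁅⁆-injective (cong set eq)))
  surjective
  (λ u v → mk⇔ (slide u v) (unslide u v)))
  where
  H = pullback (from φ) G

  singleton : Fin _ → Clique H 1
  singleton a = mkClique ⁅ a ⁆ (∣⁅x⁆∣≡1 a) (λ x∈ y∈ x≢y →
    contradiction (trans (x∈⁅y⁆⇒x≡y a x∈) (sym (x∈⁅y⁆⇒x≡y a y∈))) x≢y)

  vertex = singleton ∘ to φ

  surjective : ∀ A → ∃[ v ] vertex v ≡ A
  surjective A with a , eq ← ∣p∣≡1⇒p≡⁅x⁆ (set A) (size-≡ A) =
    from φ a , Clique-≡ (trans (cong ⁅_⁆ (strictlyInverseˡ φ a)) (sym eq))

  diff : ∀ {a b : Fin _} → a ≢ b → ⁅ a ⁆ ─ ⁅ b ⁆ ≡ ⁅ a ⁆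
  diff {a} a≢b = ─≡⁅⁆⁺ (x∈⁅x⁆ a) (a≢b ∘ x∈⁅y⁆⇒x≡y _) (λ x∈a _ → x∈⁅y⁆⇒x≡y a x∈a)

  slide : ∀ u v → Adj G u v → Adj (TS 1 H) (vertex u) (vertex v)
  slide u v uv = to φ u , to φ v , diff to-≢ , diff (≢-sym to-≢) ,
    subst₂ (Adj G) (sym (strictlyInverseʳ φ u)) (sym (strictlyInverseʳ φ v)) uv
    where
    to-≢ : to φ u ≢ to φ v
    to-≢ eq = irrefl G (from-injective (↔-sym φ) eq) uv

  unslide : ∀ u v → Adj (TS 1 H) (vertex u) (vertex v) → Adj G u v
  unslide u v (a , b , u─v , v─u , ab) = subst₂ (Adj G)
    (trans (cong (from φ) (x∈⁅y⁆⇒x≡y _ (proj₁ (─≡⁅⁆⁻ u─v)))) (strictlyInverseʳ φ u))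
    (trans (cong (from φ) (x∈⁅y⁆⇒x≡y _ (proj₁ (─≡⁅⁆⁻ v─u)))) (strictlyInverseʳ φ v)) ab

-- Complete graphs

complete-cliqueFree : CliqueFree (suc n) (complete n)
complete-cliqueFree = colourable⇒cliqueFree (complete _) (λ v → v) (λ _ _ u≢v → u≢v)

-- The only k-clique of K_k is the full vertex set, so TS_k(K_k) is a single vertex.
K₁-everywhere : 1 ≤ k → 𝒦ᵀˢ (complete 1) k
K₁-everywhere {k} 1≤k = 1≤k , k , complete k , ≅-sym (bijection⇒≅ {G = complete 1} (λ _ → whole)
  (λ { {zero} {zero} _ → refl })
  (λ A → zero , Clique-≡ (sym (∣p∣≡n⇒p≡⊤ (size-≡ A))))
  (λ { zero zero → mk⇔ (λ 0≢0 → contradiction refl 0≢0)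
                       (λ loop → contradiction loop (irrefl (TS k (complete k)) {whole} refl)) }))
  where
  whole : Clique (complete k) k
  whole = mkClique full (∣⊤∣≡n k) (λ _ _ x≢y → x≢y)

-- The n-cliques of K_{n+1} are the complements of single vertices, and any two of them differ by a
-- slide.
n∈𝒦-complete : ∀ n → 1 ≤ n → 𝒦ᵀˢ (complete (suc n)) n
n∈𝒦-complete n 1≤n = 1≤n , suc n , K , ≅-sym (bijection⇒≅ omit
  omit-injective surjective
  (λ u v → mk⇔ (delete-adj whole ∈⊤ ∈⊤)
    (λ uv u≡v → irrefl (TS n K) {omit u} {omit v} (cong omit u≡v) uv)))
  where
  K = complete (suc n)

  whole : Clique K (suc n)
  whole = mkClique full (∣⊤∣≡n (suc n)) (λ _ _ x≢y → x≢y)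

  omit : Fin (suc n) → Clique K n
  omit x = delete whole x ∈⊤

  omit-injective : Injective _≡_ _≡_ omit
  omit-injective {x} {y} eq with x Fin.≟ y
  ... | yes x≡y = x≡y
  -- Omitting distinct vertices gives adjacent cliques, and adjacent cliques are unequal.
  ... | no  x≢y = contradiction (delete-adj whole ∈⊤ ∈⊤ x≢y) (irrefl (TS n K) {omit x} {omit y} eq)

  ∣∁A∣≡1 : (A : Clique K n) → ∣ ∁ (set A) ∣ ≡ 1
  ∣∁A∣≡1 A = trans (∣∁p∣≡n∸∣p∣ (set A)) (trans (cong (suc n ∸_) (size-≡ A)) (ℕ.m+n∸n≡m 1 n))

  surjective : ∀ A → ∃[ x ] omit x ≡ A
  surjective A with x , eq ← ∣p∣≡1⇒p≡⁅x⁆ (∁ (set A)) (∣∁A∣≡1 A) = x , Clique-≡ (⊆-antisym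
    (λ y∈ → x∉∁p⇒x∈p λ y∈∁ → x∈p─q⇒x∉q full ⁅ x ⁆ y∈ (subst (_ ∈_) eq y∈∁))
    (λ y∈A → x∈p∧x∉q⇒x∈p─q ∈⊤ λ y∈x → x∈p⇒x∉∁p y∈A (subst (_ ∈_) (sym eq) y∈x)))

-- Any edge yields a (k + 1)-clique `Q`. If the images of its deletions fill K_n, counting gives n =
-- k + 1; a vertex left over comes from a clique adjacent to all deletions, which forces k = 1.
𝒦-complete⊆ : 3 ≤ n → 𝒦ᵀˢ (complete n) k → 1 ≡ k ⊎ n ∸ 1 ≡ k
𝒦-complete⊆ {suc (suc n)} {k} (s≤s (s≤s _)) k∈@(_ , _ , H , φ) =
  [ inj₂ ∘ all-hit , inj₁ ∘ some-missed ]′ (toSum (Fin.all? hit?))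
  where
  edge : Adj (complete (suc (suc n))) zero (suc zero)
  edge ()

  Q = edge⇒clique φ edge

  Hit : Fin (suc (suc n)) → Set
  Hit y = ∃[ i ] to (vertices φ) (deleteNth Q i) ≡ y

  hit? : ∀ y → Dec (Hit y)
  hit? y = Fin.any? (λ i → to (vertices φ) (deleteNth Q i) Fin.≟ y)

  all-hit : (∀ y → Hit y) → suc n ≡ k
  all-hit hit = ℕ.suc-injective (ℕ.≤-antisym
    -- Choosing a preimage for each vertex embeds the vertices of the complete graph into the k + 1
    -- indices of `Q`; clique-freeness supplies the reverse inequality.
    (subst (suc (suc n) ≤_) (size-≡ Q) (Fin.injective⇒≤ section-injective))
    (ℕ.≤-pred (𝒦-bound edge complete-cliqueFree k∈)))
    where
    section-injective : Injective _≡_ _≡_ (proj₁ ∘ hit)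
    section-injective {x} {y} eq = trans (sym (proj₂ (hit x)))
      (trans (cong (to (vertices φ) ∘ deleteNth Q) eq) (proj₂ (hit y)))

  some-missed : ¬ (∀ y → Hit y) → 1 ≡ k
  some-missed ¬hit with y , missed ← Fin.¬∀⟶∃¬ _ Hit hit? ¬hit =
    sym (adjacent-to-all⇒k≡1 Q C C-adj)
    where
    C = from (vertices φ) y

    C-adj : ∀ {x} (x∈Q : x ∈ set Q) → Adj (TS k H) C (delete Q x x∈Q)
    -- Each deletion is some `deleteNth Q i`; if it had the same image as `C`, then `y` would be
    -- hit.
    C-adj x∈Q with i , refl ← enum-surjective (set Q) x∈Q =
      Equivalence.from (adjacent φ C (deleteNth Q i)) λ eq →
        missed (i , trans (sym eq) (strictlyInverseˡ (vertices φ) y))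

-- Paths, cycles and complete bipartite graphs

-- An orientation with out-degrees at most one makes every triangle a directed cycle.
functional⇒triangle-free : {R : Rel V 0ℓ} (_≟ⱽ_ : DecidableEquality V) (R? : Decidable R) →
  (∀ {x y z} → R x y → R x z → y ≡ z) → (∀ {x y z} → R x y → R y z → R z x → ⊥) →
  CliqueFree 3 (fromRel _≟ⱽ_ R?)
functional⇒triangle-free _ _ fun acyclic f adj
  with x≢y , xy ← adj {zero} {suc zero} (λ ())
     | y≢z , yz ← adj {suc zero} {suc (suc zero)} (λ ())
     | z≢x , zx ← adj {suc (suc zero)} {zero} (λ ())
  with xy | yz | zx
... | inj₁ xy | inj₁ yz | inj₁ zx = acyclic xy yz zx
... | inj₁ xy | inj₁ yz | inj₂ xz = y≢z (fun xy xz)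
... | inj₁ xy | inj₂ zy | inj₁ zx = x≢y (fun zx zy)
... | inj₁ xy | inj₂ zy | inj₂ xz = y≢z (fun xy xz)
... | inj₂ yx | inj₁ yz | inj₁ zx = z≢x (fun yz yx)
... | inj₂ yx | inj₁ yz | inj₂ xz = z≢x (fun yz yx)
... | inj₂ yx | inj₂ zy | inj₁ zx = x≢y (fun zx zy)
... | inj₂ yx | inj₂ zy | inj₂ xz = acyclic xz zy yx

-- Every step raises `toℕ`, so three steps cannot return to their start.
path-triangle-free : ∀ n → CliqueFree 3 (path n)
path-triangle-free n = functional⇒triangle-free Fin._≟_ (λ i j → suc (toℕ i) ≟ toℕ j)
  (λ xy xz → Fin.toℕ-injective (trans (sym xy) xz))
  (λ xy yz zx → ℕ.<-irrefl refl (ℕ.<-trans (ℕ.≤-reflexive xy)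
    (ℕ.<-trans (ℕ.≤-reflexive yz) (ℕ.≤-reflexive zx))))

CycleStep : ∀ n → Rel (Fin n) 0ℓ
CycleStep n i j = suc (toℕ i) ≡ toℕ j ⊎ (suc (toℕ i) ≡ n × toℕ j ≡ 0)

-- A wrap leaves only from the last vertex, and from there an ordinary step would need a vertex with
-- `toℕ` equal to `n`.
cycleStep-functional : ∀ {x y z : Fin n} → CycleStep n x y → CycleStep n x z → y ≡ z
cycleStep-functional (inj₁ xy) (inj₁ xz) = Fin.toℕ-injective (trans (sym xy) xz)
cycleStep-functional {y = y} (inj₁ xy) (inj₂ (xn , _)) =
  contradiction (trans (sym xy) xn) (ℕ.<⇒≢ (Fin.toℕ<n y))
cycleStep-functional {z = z} (inj₂ (xn , _)) (inj₁ xz) =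
  contradiction (trans (sym xz) xn) (ℕ.<⇒≢ (Fin.toℕ<n z))
cycleStep-functional (inj₂ (_ , y0)) (inj₂ (_ , z0)) = Fin.toℕ-injective (trans y0 (sym z0))

-- The cases are sorted by the number of wraps: none contradicts the growth of `toℕ`, one forces `n`
-- to be 3, and two consecutive wraps force `n` to be 1.
cycleStep-no-triangle : 4 ≤ n → ∀ {x y z : Fin n} →
  CycleStep n x y → CycleStep n y z → CycleStep n z x → ⊥
cycleStep-no-triangle {n} 4≤n {x} {y} {z} = go
  where
  short : ∀ {m} → m < 4 → m ≢ n
  short m<4 refl = ℕ.<⇒≱ m<4 4≤n

  one-wrap : ∀ {a b c : Fin n} → suc (toℕ a) ≡ toℕ b → suc (toℕ b) ≡ toℕ c →
    suc (toℕ c) ≡ n → toℕ a ≡ 0 → ⊥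
  one-wrap ab bc cn a0 = short (ℕ.n<1+n 3)
    (trans (cong suc (trans (cong suc (trans (cong suc (sym a0)) ab)) bc)) cn)

  two-wraps : ∀ {a : Fin n} → suc (toℕ a) ≡ n → toℕ a ≡ 0 → ⊥
  two-wraps an a0 = short (s≤s (s≤s z≤n)) (trans (cong suc (sym a0)) an)

  go : CycleStep n x y → CycleStep n y z → CycleStep n z x → ⊥
  go (inj₁ xy) (inj₁ yz) (inj₁ zx) = ℕ.<-irrefl refl (ℕ.<-trans (ℕ.≤-reflexive xy)
    (ℕ.<-trans (ℕ.≤-reflexive yz) (ℕ.≤-reflexive zx)))
  go (inj₁ xy) (inj₁ yz) (inj₂ (zn , x0)) = one-wrap xy yz zn x0
  go (inj₁ xy) (inj₂ (yn , z0)) (inj₁ zx) = one-wrap zx xy yn z0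
  go (inj₂ (xn , y0)) (inj₁ yz) (inj₁ zx) = one-wrap yz zx xn y0
  go (inj₁ xy) (inj₂ (yn , z0)) (inj₂ (zn , x0)) = two-wraps zn z0
  go (inj₂ (xn , y0)) (inj₁ yz) (inj₂ (zn , x0)) = two-wraps xn x0
  go (inj₂ (xn , y0)) (inj₂ (yn , z0)) _ = two-wraps yn y0

cycle-triangle-free : ∀ n → 4 ≤ n → CliqueFree 3 (cycle n)
cycle-triangle-free n 4≤n =
  functional⇒triangle-free {R = CycleStep n} Fin._≟_
    (λ i j → (suc (toℕ i) ≟ toℕ j) ⊎-dec ((suc (toℕ i) ≟ n) ×-dec (toℕ j ≟ 0)))
    cycleStep-functional (cycleStep-no-triangle 4≤n)

completeBipartite-triangle-free : ∀ m n → CliqueFree 3 (completeBipartite m n)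
completeBipartite-triangle-free m n = colourable⇒cliqueFree (completeBipartite m n) side proper
  where
  side : Fin m ⊎ Fin n → Fin 2
  side (inj₁ _) = zero
  side (inj₂ _) = suc zero

  proper : ∀ u v → Adj (completeBipartite m n) u v → side u ≢ side v
  proper (inj₁ _) (inj₁ _) (_ , inj₁ ())
  proper (inj₁ _) (inj₁ _) (_ , inj₂ ())
  proper (inj₁ _) (inj₂ _) _ ()
  proper (inj₂ _) (inj₁ _) _ ()
  proper (inj₂ _) (inj₂ _) (_ , inj₁ ())
  proper (inj₂ _) (inj₂ _) (_ , inj₂ ())

-- Books and friendship graphs

-- The apexes are pairwise nonadjacent, so one colour serves them all and each spine vertex gets its
-- own.
book-K₄-free : ∀ p → CliqueFree 4 (book p)
book-K₄-free p = colourable⇒cliqueFree (book p) colour proper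
  where
  colour : Fin 2 ⊎ Fin p → Fin 3
  colour (inj₁ zero)       = zero
  colour (inj₁ (suc zero)) = suc zero
  colour (inj₂ _)          = suc (suc zero)

  proper : ∀ u v → Adj (book p) u v → colour u ≢ colour v
  proper (inj₁ zero)       (inj₁ zero)       (u≢v , _) _ = u≢v refl
  proper (inj₁ (suc zero)) (inj₁ (suc zero)) (u≢v , _) _ = u≢v refl
  proper (inj₁ zero)       (inj₁ (suc zero)) _ ()
  proper (inj₁ (suc zero)) (inj₁ zero)       _ ()
  proper (inj₁ zero)       (inj₂ _) _ ()
  proper (inj₁ (suc zero)) (inj₂ _) _ ()
  proper (inj₂ _) (inj₁ zero)       _ ()
  proper (inj₂ _) (inj₁ (suc zero)) _ ()
  proper (inj₂ _) (inj₂ _) (_ , inj₁ ())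
  proper (inj₂ _) (inj₂ _) (_ , inj₂ ())

spine : Adj (book p) (inj₁ zero) (inj₁ (suc zero))
spine = (λ ()) , inj₁ tt

-- Neighbours of an apex lie on the spine, and `x` is not the spine vertex to which it is adjacent.
book-common-neighbour : ∀ {p} (x : Fin 2 ⊎ Fin p) {i} →
  Adj (book p) x (inj₁ zero) → Adj (book p) x (inj₂ i) → x ≡ inj₁ (suc zero)
book-common-neighbour (inj₁ zero)       (x≢0 , _) _ = contradiction refl x≢0
book-common-neighbour (inj₁ (suc zero)) _ _ = refl
book-common-neighbour (inj₂ _) _ (_ , inj₁ ())
book-common-neighbour (inj₂ _) _ (_ , inj₂ ())

-- For each apex `C i`, the symmetric difference of `A` and `C i` is a common neighbour of both,
-- hence is `B`. Cancelling `A` then identifies two distinct apexes.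
2∉𝒦-book : ∀ p → ¬ 𝒦ᵀˢ (book (suc (suc p))) 2
2∉𝒦-book p (_ , _ , H , φ) = contradiction (from-injective (vertices φ) apexes-equal) λ ()
  where
  A = from (vertices φ) (inj₁ zero)
  B = from (vertices φ) (inj₁ (suc zero))
  C = from (vertices φ) ∘ inj₂

  B≡A△C : ∀ i → set B ≡ (set A ─ set (C i)) ∪ˢ (set (C i) ─ set A)
  B≡A△C i with D , D≡ , DA , DC ← symmetricDifference-common A (C i) (edge-pull φ ((λ ()) , inj₁ tt))
    = trans (cong set (sym D≡B)) D≡
    where
    to-D : to (vertices φ) D ≡ inj₁ (suc zero)
    to-D = book-common-neighbour (to (vertices φ) D)
      (subst (Adj (book _) _) (strictlyInverseˡ (vertices φ) _) (edge-push φ {D} {A} DA))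
      (subst (Adj (book _) _) (strictlyInverseˡ (vertices φ) _) (edge-push φ {D} {C i} DC))

    D≡B : D ≡ B
    D≡B = trans (sym (strictlyInverseʳ (vertices φ) D)) (cong (from (vertices φ)) to-D)

  apexes-equal : C zero ≡ C (suc zero)
  apexes-equal = Clique-≡ (symmetricDifference-cancelˡ (set A) _ _
    (trans (sym (B≡A△C zero)) (B≡A△C (suc zero))))

-- Carries the representation of K_3 by its own 2-cliques over to B_1.
K₃≅B₁ : complete 3 ≅ book 1
K₃≅B₁ = record
  { vertices = Fin.+↔⊎
  ; adjacent = λ u v → mk⇔
      (λ u≢v → adj _ _ (u≢v ∘ from-injective (↔-sym (Fin.+↔⊎ {2} {1}))))
      (λ uv u≡v → irrefl (book 1) (cong (to (Fin.+↔⊎ {2} {1})) u≡v) uv)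
  }
  where
  adj : ∀ u v → u ≢ v → Adj (book 1) u v
  adj (inj₁ _)    _           u≢v = u≢v , inj₁ tt
  adj (inj₂ _)    (inj₁ _)    u≢v = u≢v , inj₂ tt
  adj (inj₂ zero) (inj₂ zero) u≢v = contradiction refl u≢v

-- One colour for the hub and two for the outer vertices suffice, since outer vertices of different
-- triangles are nonadjacent.
friendship-K₄-free : ∀ p → CliqueFree 4 (friendship p)
friendship-K₄-free p = colourable⇒cliqueFree (friendship p) colour proper
  where
  colour : ⊤ ⊎ (Fin p × Fin 2) → Fin 3
  colour (inj₁ _)       = zero
  colour (inj₂ (_ , b)) = suc b

  proper : ∀ u v → Adj (friendship p) u v → colour u ≢ colour v
  proper (inj₁ _) (inj₁ _) (u≢v , _) _ = u≢v refl
  proper (inj₁ _) (inj₂ _) _ ()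
  proper (inj₂ _) (inj₁ _) _ ()
  proper (inj₂ (i , _)) (inj₂ (_ , _)) (u≢v , inj₁ refl) refl = u≢v refl
  proper (inj₂ (i , _)) (inj₂ (_ , _)) (u≢v , inj₂ refl) refl = u≢v refl

friendship-vertices : ∀ p → (⊤ ⊎ (Fin p × Fin 2)) ↔ Fin (1 + p * 2)
friendship-vertices p =
  ↔-sym (↔-trans Fin.+↔⊎ (Fin.1↔⊤ ⊎-↔ Fin.*↔×))

2∈𝒦-friendship : ∀ p → 𝒦ᵀˢ (friendship p) 2
2∈𝒦-friendship p = s≤s z≤n , 2 + p , B , ≅-sym (bijection⇒≅ {G = friendship p} edge
  edge-injective surjective (λ u v → mk⇔ (slide u v) (unslide u v)))
  where
  B = pullback (to (Fin.+↔⊎ {2} {p})) (book p)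

  -- The hub is the spine edge, and `(i , b)` is the edge joining spine vertex `b` to apex `i`; each
  -- triangle of the friendship graph thus consists of the sides of a triangle of the book.
  edgeSet : ⊤ ⊎ (Fin p × Fin 2) → Subset (2 + p)
  edgeSet (inj₁ tt)             = true  ∷ true  ∷ empty
  edgeSet (inj₂ (i , zero))     = true  ∷ false ∷ ⁅ i ⁆
  edgeSet (inj₂ (i , suc zero)) = false ∷ true  ∷ ⁅ i ⁆

  edgeSet-size : ∀ w → ∣ edgeSet w ∣ ≡ 2
  edgeSet-size (inj₁ tt)             = cong (2 +_) (∣⊥∣≡0 p)
  edgeSet-size (inj₂ (i , zero))     = cong suc (∣⁅x⁆∣≡1 i)
  edgeSet-size (inj₂ (i , suc zero)) = cong suc (∣⁅x⁆∣≡1 i)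

  apex-unique : ∀ {i x y : Fin p} → x ∈ ⁅ i ⁆ → y ∈ ⁅ i ⁆ → x ≡ y
  apex-unique {i} x∈ y∈ = trans (x∈⁅y⁆⇒x≡y i x∈) (sym (x∈⁅y⁆⇒x≡y i y∈))

  -- Two distinct vertices of a book are adjacent as soon as one is on the spine, and no `edgeSet`
  -- contains two apexes.
  edgeSet-clique : ∀ w {x y} → x ∈ edgeSet w → y ∈ edgeSet w → x ≢ y → Adj B x y
  edgeSet-clique w {zero} {zero} _ _ x≢y = contradiction refl x≢y
  edgeSet-clique w {zero} {suc zero} _ _ _ = (λ ()) , inj₁ tt
  edgeSet-clique w {zero} {suc (suc _)} _ _ _ = (λ ()) , inj₁ tt
  edgeSet-clique w {suc zero} {zero} _ _ _ = (λ ()) , inj₁ tt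
  edgeSet-clique w {suc zero} {suc zero} _ _ x≢y = contradiction refl x≢y
  edgeSet-clique w {suc zero} {suc (suc _)} _ _ _ = (λ ()) , inj₁ tt
  edgeSet-clique w {suc (suc _)} {zero} _ _ _ = (λ ()) , inj₂ tt
  edgeSet-clique w {suc (suc _)} {suc zero} _ _ _ = (λ ()) , inj₂ tt
  edgeSet-clique (inj₁ tt) {suc (suc _)} {suc (suc _)} (there (there x∈)) _ _ =
    contradiction x∈ ∉⊥
  edgeSet-clique (inj₂ (i , zero)) {suc (suc _)} {suc (suc _)}
    (there (there x∈)) (there (there y∈)) x≢y =
    contradiction (cong (λ z → suc (suc z)) (apex-unique x∈ y∈)) x≢y
  edgeSet-clique (inj₂ (i , suc zero)) {suc (suc _)} {suc (suc _)}
    (there (there x∈)) (there (there y∈)) x≢y =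
    contradiction (cong (λ z → suc (suc z)) (apex-unique x∈ y∈)) x≢y

  edge : ⊤ ⊎ (Fin p × Fin 2) → Clique B 2
  edge w = mkClique (edgeSet w) (edgeSet-size w) (edgeSet-clique w)

  edgeSet-injective : ∀ {w w′} → edgeSet w ≡ edgeSet w′ → w ≡ w′
  edgeSet-injective {inj₁ tt} {inj₁ tt} _ = refl
  edgeSet-injective {inj₁ tt} {inj₂ (_ , zero)} ()
  edgeSet-injective {inj₁ tt} {inj₂ (_ , suc zero)} ()
  edgeSet-injective {inj₂ (_ , zero)} {inj₁ tt} ()
  edgeSet-injective {inj₂ (_ , suc zero)} {inj₁ tt} ()
  edgeSet-injective {inj₂ (_ , zero)} {inj₂ (_ , suc zero)} ()
  edgeSet-injective {inj₂ (_ , suc zero)} {inj₂ (_ , zero)} ()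
  edgeSet-injective {inj₂ (_ , zero)} {inj₂ (_ , zero)} eq =
    cong (λ i → inj₂ (i , zero)) (⁅⁆-injective (∷-injectiveʳ (∷-injectiveʳ eq)))
  edgeSet-injective {inj₂ (_ , suc zero)} {inj₂ (_ , suc zero)} eq =
    cong (λ i → inj₂ (i , suc zero)) (⁅⁆-injective (∷-injectiveʳ (∷-injectiveʳ eq)))

  edge-injective : Injective _≡_ _≡_ edge
  edge-injective eq = edgeSet-injective (cong set eq)

  -- The first two bits tell which spine vertices `s` contains; if it contained neither, its two
  -- members would be adjacent apexes.
  covered : (s : Subset (2 + p)) → ∣ s ∣ ≡ 2 →
    (∀ {x y} → x ∈ s → y ∈ s → x ≢ y → Adj B x y) → ∃[ w ] edgeSet w ≡ s
  covered (true ∷ true ∷ s) size _ =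
    inj₁ tt , cong (λ s → true ∷ true ∷ s) (sym (∣p∣≡0⇒p≡⊥ s (ℕ.suc-injective (ℕ.suc-injective size))))
  covered (true ∷ false ∷ s) size _ with i , refl ← ∣p∣≡1⇒p≡⁅x⁆ s (ℕ.suc-injective size) =
    inj₂ (i , zero) , refl
  covered (false ∷ true ∷ s) size _ with i , refl ← ∣p∣≡1⇒p≡⁅x⁆ s (ℕ.suc-injective size) =
    inj₂ (i , suc zero) , refl
  -- Abstracting `∣ s ∣` together with its enumeration lets `size` be matched with `refl`, so that
  -- `e` is indexed by `Fin 2`.
  covered (false ∷ false ∷ s) size adj with ∣ s ∣ | enum s | enum-injective s
  covered (false ∷ false ∷ s) refl adj | .2 | e | e-injective
    with x , x∈ ← e zero in ex | y , y∈ ← e (suc zero) in ey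
    with adj (there (there x∈)) (there (there y∈))
           (λ eq → contradiction (e-injective (trans (cong proj₁ ex)
             (trans (Fin.suc-injective (Fin.suc-injective eq)) (sym (cong proj₁ ey))))) λ ())
  ... | _ , inj₁ ()
  ... | _ , inj₂ ()

  surjective : ∀ A → ∃[ w ] edge w ≡ A
  surjective A = let w , eq = covered (set A) (size-≡ A) (clique-adj A) in w , Clique-≡ eq

  hub-slide : ∀ i b → Adj (TS 2 B) (edge (inj₁ tt)) (edge (inj₂ (i , b)))
  -- The token on the spine vertex other than `b` moves to the apex.
  hub-slide i zero = suc zero , suc (suc i) ,
    cong (λ s → false ∷ true ∷ s) (⊥─p≡⊥ ⁅ i ⁆) , cong (λ s → false ∷ false ∷ s) (p─⊥≡p _) , (λ ()) , inj₁ tt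
  hub-slide i (suc zero) = zero , suc (suc i) ,
    cong (λ s → true ∷ false ∷ s) (⊥─p≡⊥ ⁅ i ⁆) , cong (λ s → false ∷ false ∷ s) (p─⊥≡p _) , (λ ()) , inj₁ tt

  triangle-slide : ∀ i → Adj (TS 2 B) (edge (inj₂ (i , zero))) (edge (inj₂ (i , suc zero)))
  triangle-slide i = zero , suc zero ,
    cong (λ s → true ∷ false ∷ s) (p─p≡⊥ ⁅ i ⁆) , cong (λ s → false ∷ true ∷ s) (p─p≡⊥ ⁅ i ⁆) ,
    (λ ()) , inj₁ tt

  sym-slide : ∀ u v → Adj (TS 2 B) (edge u) (edge v) → Adj (TS 2 B) (edge v) (edge u)
  sym-slide u v = symm (TS 2 B) {edge u} {edge v}

  same-slide : ∀ i b c → b ≢ c → Adj (TS 2 B) (edge (inj₂ (i , b))) (edge (inj₂ (i , c)))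
  same-slide i zero       zero       b≢c = contradiction refl b≢c
  same-slide i zero       (suc zero) _   = triangle-slide i
  same-slide i (suc zero) zero       _   =
    sym-slide (inj₂ (i , zero)) (inj₂ (i , suc zero)) (triangle-slide i)
  same-slide i (suc zero) (suc zero) b≢c = contradiction refl b≢c

  slide : ∀ u v → Adj (friendship p) u v → Adj (TS 2 B) (edge u) (edge v)
  slide (inj₁ tt)      (inj₁ tt)      (u≢v , _) = contradiction refl u≢v
  slide (inj₁ tt)      (inj₂ (i , b)) _ = hub-slide i b
  slide (inj₂ (i , b)) (inj₁ tt)      _ = sym-slide (inj₁ tt) (inj₂ (i , b)) (hub-slide i b)
  slide (inj₂ (i , b)) (inj₂ (_ , c)) (u≢v , inj₁ refl) =
    same-slide i b c (u≢v ∘ cong (λ b → inj₂ (i , b)))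
  slide (inj₂ (i , b)) (inj₂ (_ , c)) (u≢v , inj₂ refl) =
    same-slide i b c (u≢v ∘ cong (λ b → inj₂ (i , b)))

  apex∈ : ∀ i b → suc (suc i) ∈ edgeSet (inj₂ (i , b))
  apex∈ i zero       = there (there (x∈⁅x⁆ i))
  apex∈ i (suc zero) = there (there (x∈⁅x⁆ i))

  apex∉ : ∀ {i j} b → i ≢ j → suc (suc i) ∉ edgeSet (inj₂ (j , b))
  apex∉ zero       i≢j (there (there i∈)) = i≢j (x∈⁅y⁆⇒x≡y _ i∈)
  apex∉ (suc zero) i≢j (there (there i∈)) = i≢j (x∈⁅y⁆⇒x≡y _ i∈)

  -- A slide between edges with different apexes moves one apex to the other,
  -- but apexes are not adjacent.
  same-apex : ∀ i j b c → Adj (TS 2 B) (edge (inj₂ (i , b))) (edge (inj₂ (j , c))) → i ≡ j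
  same-apex i j b c (u , v , u─v , v─u , uv) with i Fin.≟ j
  ... | yes i≡j = i≡j
  ... | no  i≢j
    with refl ← proj₂ (proj₂ (─≡⁅⁆⁻ u─v)) (apex∈ i b) (apex∉ c i≢j)
       | refl ← proj₂ (proj₂ (─≡⁅⁆⁻ v─u)) (apex∈ j c) (apex∉ b (≢-sym i≢j))
    with uv
  ... | _ , inj₁ ()
  ... | _ , inj₂ ()

  unslide : ∀ u v → Adj (TS 2 B) (edge u) (edge v) → Adj (friendship p) u v
  unslide u v uv = u≢v , related u v uv
    where
    u≢v : u ≢ v
    u≢v u≡v = irrefl (TS 2 B) {edge u} {edge v} (cong edge u≡v) uv

    related : ∀ u v → Adj (TS 2 B) (edge u) (edge v) →
      HubOrSameTriangle u v ⊎ HubOrSameTriangle v u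
    related (inj₁ tt)      _              _  = inj₁ tt
    related (inj₂ _)       (inj₁ tt)      _  = inj₂ tt
    related (inj₂ (i , b)) (inj₂ (j , c)) uv = inj₁ (same-apex i j b c uv)

-- Token numbers of the listed graph families

theorem3p3 : ( 𝒦ᵀˢ (complete 1) ≐ (λ k → 1 ≤ k)
    × 𝒦ᵀˢ (complete 2) ≐ ｛ 1 ｝
    × (∀ (n : ℕ) → 3 ≤ n → 𝒦ᵀˢ (complete n) ≐ (｛ 1 ｝ ∪ ｛ n ∸ 1 ｝)) )
    ×
    ( (∀ (n : ℕ) → 2 ≤ n → 𝒦ᵀˢ (path n) ≐ ｛ 1 ｝)
    × (∀ (n : ℕ) → 4 ≤ n → 𝒦ᵀˢ (cycle n) ≐ ｛ 1 ｝)
    × (∀ (m n : ℕ) → 1 ≤ m → 1 ≤ n → 𝒦ᵀˢ (completeBipartite m n) ≐ ｛ 1 ｝) )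
    ×
    ( 𝒦ᵀˢ (book 1) ≐ (｛ 1 ｝ ∪ ｛ 2 ｝)
    × (∀ (p : ℕ) → 2 ≤ p → 𝒦ᵀˢ (book p) ≐ ｛ 1 ｝) )
    ×
    (∀ (p : ℕ) → 1 ≤ p → 𝒦ᵀˢ (friendship p) ≐ (｛ 1 ｝ ∪ ｛ 2 ｝))
theorem3p3 =
    ( (proj₁ , K₁-everywhere)
    -- K_2 has an edge but no K_3.
    , (𝒦-triangle-free {u = zero} {v = suc zero} (λ ()) complete-cliqueFree
      , λ { refl → 1∈𝒦 ↔-refl (complete 2) })
    , λ n 3≤n → 𝒦-complete⊆ 3≤n , λ
      { (inj₁ refl) → 1∈𝒦 ↔-refl (complete n)
      ; (inj₂ refl) → pred∈𝒦-complete n 3≤n } )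
  , ( (λ n 2≤n → path⊆ n 2≤n , λ { refl → 1∈𝒦 ↔-refl (path n) })
    , (λ n 4≤n → cycle⊆ n 4≤n , λ { refl → 1∈𝒦 ↔-refl (cycle n) })
    , (λ m n 1≤m 1≤n → completeBipartite⊆ m n 1≤m 1≤n ,
      λ { refl → 1∈𝒦 (↔-sym Fin.+↔⊎) (completeBipartite m n) }) )
  , ( ( (λ k∈ → 1-or-2 (proj₁ k∈) (𝒦-bound spine (book-K₄-free 1) k∈))
      , λ { (inj₁ refl) → 1∈𝒦 (↔-sym Fin.+↔⊎) (book 1)
          ; (inj₂ refl) → 𝒦-resp-≅ K₃≅B₁ (n∈𝒦-complete 2 (s≤s z≤n)) } )
    , λ p 2≤p → book⊆ p 2≤p , λ { refl → 1∈𝒦 (↔-sym Fin.+↔⊎) (book p) } )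
  , λ p 1≤p → friendship⊆ p 1≤p ,
      λ { (inj₁ refl) → 1∈𝒦 (friendship-vertices p) (friendship p)
        ; (inj₂ refl) → 2∈𝒦-friendship p }
  where
  -- The second hypothesis is the bound obtained from K_4-freeness, for books and friendship graphs
  -- alike.
  1-or-2 : ∀ {k} → 1 ≤ k → suc k < 4 → 1 ≡ k ⊎ 2 ≡ k
  1-or-2 {1} _ _ = inj₁ refl
  1-or-2 {2} _ _ = inj₂ refl
  1-or-2 {suc (suc (suc _))} _ (s≤s (s≤s (s≤s (s≤s ()))))

  pred∈𝒦-complete : ∀ n → 3 ≤ n → 𝒦ᵀˢ (complete n) (n ∸ 1)
  pred∈𝒦-complete (suc n) (s≤s 2≤n) = n∈𝒦-complete n (ℕ.<⇒≤ 2≤n)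

  path⊆ : ∀ n {k} → 2 ≤ n → 𝒦ᵀˢ (path n) k → 1 ≡ k
  path⊆ (suc (suc n)) (s≤s (s≤s _)) =
    𝒦-triangle-free {u = zero} {v = suc zero} ((λ ()) , inj₁ refl) (path-triangle-free _)

  cycle⊆ : ∀ n {k} → 4 ≤ n → 𝒦ᵀˢ (cycle n) k → 1 ≡ k
  cycle⊆ (suc (suc n)) 4≤n@(s≤s (s≤s _)) =
    𝒦-triangle-free {u = zero} {v = suc zero} ((λ ()) , inj₁ (inj₁ refl)) (cycle-triangle-free _ 4≤n)

  completeBipartite⊆ : ∀ m n {k} → 1 ≤ m → 1 ≤ n → 𝒦ᵀˢ (completeBipartite m n) k → 1 ≡ k
  completeBipartite⊆ (suc m) (suc n) _ _ =
    𝒦-triangle-free {u = inj₁ zero} {v = inj₂ zero} ((λ ()) , inj₁ tt)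
      (completeBipartite-triangle-free _ _)

  book⊆ : ∀ p {k} → 2 ≤ p → 𝒦ᵀˢ (book p) k → 1 ≡ k
  book⊆ (suc (suc p)) (s≤s (s≤s _)) k∈
    with 1-or-2 (proj₁ k∈) (𝒦-bound spine (book-K₄-free (suc (suc p))) k∈)
  ... | inj₁ 1≡k  = 1≡k
  ... | inj₂ refl = contradiction k∈ (2∉𝒦-book p)

  friendship⊆ : ∀ p {k} → 1 ≤ p → 𝒦ᵀˢ (friendship p) k → 1 ≡ k ⊎ 2 ≡ k
  friendship⊆ (suc p) _ k∈ = 1-or-2 (proj₁ k∈)
    (𝒦-bound {u = inj₁ tt} {v = inj₂ (zero , zero)} ((λ ()) , inj₁ tt) (friendship-K₄-free _) k∈)
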